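{- For integers $2\le n\le m$, $$\gamma^{LD}(K_n\times K_m)=\begin{cases} m-1, & 2n\le m \text{ and } (n,m)\ne(2,4),\\ \left\lceil \frac{2n+2m-1}{3}\right\rceil-1, & 2<n\le m<2n \text{ and } (n,m)\ne(4,4),\\ m, & n=2,\ m\le 4,\\ 5, & n=m=4.\end{cases}$$
   Context: $K_q$ is the complete graph on vertex set $\{1,\dots,q\}$. The direct product $G_1\times G_2$ has vertex set $V_1\times V_2$, with $(u_1,u_2)$ adjacent to $(v_1,v_2)$ iff $u_1v_1\in E_1$ and $u_2v_2\in E_2$. For a code (nonempty vertex subset) $C$ and vertex $v$, $I(C;v)=N[v]\cap C$, where $N[v]$ is the closed neighbourhood. A code $C$ is locating-dominating if for all distinct non-codewords $u,v$, $I(C;u)\ne\emptyset$ and $I(C;u)\ne I(C;v)$. $\gamma^{LD}(G)$ is the minimum size of a locating-dominating code in $G$. -}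

module Defs where

open import Data.Fin.Base using (Fin)
open import Data.List.Base using (List; []; length)
open import Data.List.Membership.Propositional using (_∈_)
open import Data.List.Relation.Unary.Unique.Propositional using (Unique)
open import Data.Nat.Base using (ℕ; _+_; _∸_; _≤_; _/_; NonZero)
open import Data.Product.Base using (_×_; _,_; ∃-syntax)
open import Relation.Binary.PropositionalEquality using (_≡_; _≢_; refl; ≢-sym)
open import Relation.Nullary.Negation using (¬_)
open import Relation.Unary using (Pred; ｛_｝; _∪_; _∩_; _≐_; Satisfiable)

record Graph : Set₁ where
  field
    Vertex     : Set
    Adj        : Vertex → Vertex → Set
    adj-sym    : ∀ {u v} → Adj u v → Adj v u
    adj-irrefl : ∀ {v} → ¬ Adj v v

open Graph public

K : ℕ → Graph
K q = record
  { Vertex     = Fin q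
  ; Adj        = _≢_
  ; adj-sym    = ≢-sym
  ; adj-irrefl = λ v≢v → v≢v refl
  }

infixr 7 _×ᴳ_

_×ᴳ_ : Graph → Graph → Graph
G₁ ×ᴳ G₂ = record
  { Vertex     = Vertex G₁ × Vertex G₂
  ; Adj        = λ (u₁ , u₂) (v₁ , v₂) → Adj G₁ u₁ v₁ × Adj G₂ u₂ v₂
  ; adj-sym    = λ (e₁ , e₂) → adj-sym G₁ e₁ , adj-sym G₂ e₂
  ; adj-irrefl = λ (e , _) → adj-irrefl G₁ e
  }

-- A finite subset is represented by a duplicate-free enumeration, so that
-- its cardinality is the length of the list.
record Code (G : Graph) : Set where
  field
    codewords : List (Vertex G)
    distinct  : Unique codewords
    nonempty  : codewords ≢ []

  IsCodeword : Pred (Vertex G) _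
  IsCodeword v = v ∈ codewords

  size : ℕ
  size = length codewords

open Code public using (codewords; IsCodeword; size)

N[_] : {G : Graph} → Vertex G → Pred (Vertex G) _
N[_] {G} v = ｛ v ｝ ∪ Adj G v

I : {G : Graph} → Code G → Vertex G → Pred (Vertex G) _
I {G} C v = N[_] {G} v ∩ IsCodeword C

LocatingDominating : {G : Graph} → Code G → Set
LocatingDominating {G} C =
  ∀ (u v : Vertex G) → ¬ IsCodeword C u → ¬ IsCodeword C v → u ≢ v →
  Satisfiable (I C u) × ¬ (I C u ≐ I C v)

-- γᴸᴰ G ≔ k  means that the minimum size of a locating-dominating code
-- in G exists and equals k.
infix 4 γᴸᴰ_≔_

γᴸᴰ_≔_ : Graph → ℕ → Set
γᴸᴰ G ≔ k =
  (∃[ C ] LocatingDominating {G} C × size C ≡ k) ×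
  (∀ (C : Code G) → LocatingDominating C → k ≤ size C)

⌈_/_⌉ : (a b : ℕ) .{{_ : NonZero b}} → ℕ
⌈ a / b ⌉ = (a + (b ∸ 1)) / b

{-# OPTIONS --safe #-}
module Submission where

-- Read a code in K n × K m as the edge set of a bipartite graph on n rows and
-- m columns.  It is locating iff there is at most one isolated row, at most one
-- isolated column, and at most one "solo" cell, a solo cell being an isolated
-- edge or the crossing of an isolated row with an isolated column; it is
-- dominating iff no non-edge meets every edge.  The lower bounds come from
-- m ≤ e + 1 and, by discharging, 2 n + 2 m ≤ 3 e + 4.  Optimal codes consist
-- almost entirely of stars with two leaves: adding a star centred at a new row
-- (column) raises (n , m , e) by (1 , 2 , 2) (by (2 , 1 , 2)).  From a few small
-- codes these moves reach every pair with m < 2 n, and once extra columns are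
-- attached to a nonempty row, every pair with 2 n ≤ m.

open import Data.Bool.Base using (if_then_else_)
open import Data.Empty using (⊥; ⊥-elim)
open import Data.Fin using (#_)
open import Data.Fin.Base using (Fin; zero; suc)
open import Data.Fin.Properties using (_≟_; all?; any?; suc-injective)
open import Data.List.Base using (List; []; _∷_; length; map)
import Data.List.Membership.DecPropositional as DecMembership
open import Data.List.Membership.Propositional using (_∈_; _∉_; find; lose)
open import Data.List.Membership.Propositional.Properties using (∈-map⁺)
open import Data.List.Properties using (map-∘; length-map; map-injective)
open import Data.List.Relation.Unary.All as All using (All; []; _∷_)
import Data.List.Relation.Unary.All.Properties as All
open import Data.List.Relation.Unary.AllPairs using ([]; _∷_)
open import Data.List.Relation.Unary.Any as Any using (Any; here; there)
import Data.List.Relation.Unary.Any.Properties as Any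
open import Data.List.Relation.Unary.Unique.DecPropositional using (unique?)
open import Data.List.Relation.Unary.Unique.Propositional using (Unique)
import Data.List.Relation.Unary.Unique.Propositional.Properties as Unique
open import Data.Nat.Base using (ℕ; zero; suc; _+_; _*_; _∸_; _≤_; _<_; z≤n; s≤s)
open import Data.Nat.Divisibility using (n∣m*n)
open import Data.Nat.DivMod using (_/_; +-distrib-/-∣ˡ; m*n/n≡m; m<n⇒m/n≡0)
import Data.Nat.ListAction as List
open import Data.Nat.Properties renaming (_≟_ to _≟ℕ_) hiding (suc-injective)
open import Data.Nat.Tactic.RingSolver using (solve-∀)
open import Data.Product.Base as Product using (_×_; _,_; proj₁; proj₂; ∃-syntax; curry; uncurry; swap)
open import Data.Product.Properties using (≡-dec)
open import Data.Sum.Base as Sum using (_⊎_; inj₁; inj₂)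
open import Defs
open import Function.Base using (_∘_; case_of_)
open import Relation.Binary.Definitions using (DecidableEquality)
open import Relation.Binary.PropositionalEquality
open import Relation.Nullary
  using (¬_; Dec; does; yes; no; True; toWitness; from-no; contradiction; ¬?; map′; _×-dec_; _⊎-dec_; _→-dec_)
open import Relation.Unary using (Pred; Decidable)

open import Algebra.Properties.CommutativeMonoid.Sum +-0-commutativeMonoid
  using (sum; ∑-distrib-+; sum-cong-≗; sum-replicate-zero)

private variable
  n m e : ℕ
  A : Set

-- Locating-dominating codes in terms of empty lines and solo cells.

Cell : ℕ → ℕ → Set
Cell n m = Fin n × Fin m

_≟ᶜ_ : DecidableEquality (Cell n m)
_≟ᶜ_ = ≡-dec _≟_ _≟_

EmptyRow : List (Cell n m) → Pred (Fin n) _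
EmptyRow xs i = All (λ c → i ≢ proj₁ c) xs

EmptyCol : List (Cell n m) → Pred (Fin m) _
EmptyCol xs j = All (λ c → j ≢ proj₂ c) xs

InLine : Cell n m → Pred (Cell n m) _
InLine u c = proj₁ u ≡ proj₁ c ⊎ proj₂ u ≡ proj₂ c

Apart : Cell n m → Pred (Cell n m) _
Apart u c = proj₁ u ≢ proj₁ c × proj₂ u ≢ proj₂ c

-- A solo cell is either the only codeword in its row and its column, or the
-- crossing of an empty row with an empty column.
Solo : List (Cell n m) → Pred (Cell n m) _
Solo xs u = All (λ c → InLine u c → u ≡ c) xs

record Locating (xs : List (Cell n m)) : Set where
  constructor locating
  field
    oneEmptyRow : ∀ i i′ → EmptyRow xs i → EmptyRow xs i′ → i ≡ i′
    oneEmptyCol : ∀ j j′ → EmptyCol xs j → EmptyCol xs j′ → j ≡ j′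
    oneSolo     : ∀ u v → Solo xs u → Solo xs v → u ≡ v

-- The second non-codeword is there because LocatingDominating only speaks
-- about pairs.
Dominating : List (Cell n m) → Set
Dominating xs = ∀ u v → u ∉ xs → v ∉ xs → u ≢ v → Any (Apart u) xs

element : {xs : List A} → xs ≢ [] → ∃[ x ] x ∈ xs
element {xs = []}    xs≢[] = contradiction refl xs≢[]
element {xs = x ∷ _} _     = x , here refl

module _ (C : Code (K n ×ᴳ K m)) where

  private xs = codewords C

  LD⇒dominating : LocatingDominating C → Dominating xs
  LD⇒dominating ld u v u∉ v∉ u≢v with proj₁ (ld u v u∉ v∉ u≢v)
  ... | c , inj₁ refl  , c∈ = contradiction c∈ u∉
  ... | c , inj₂ apart , c∈ = lose c∈ apart

  module _ (ld : LocatingDominating C) where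

    private
      -- A non-codeword is absent from its own `I`-set, which thus consists of the codewords lying
      -- apart from it.
      conflict : ∀ {u v} → u ∉ xs → v ∉ xs → u ≢ v →
                 (∀ {c} → c ∈ xs → Apart u c → Apart v c) →
                 (∀ {c} → c ∈ xs → Apart v c → Apart u c) → ⊥
      conflict {u} {v} u∉ v∉ u≢v f g =
        proj₂ (ld u v u∉ v∉ u≢v) (neighbours u∉ f , neighbours v∉ g)
        where
        neighbours : ∀ {u v} → u ∉ xs → (∀ {c} → c ∈ xs → Apart u c → Apart v c) →
                     ∀ {c} → I C u c → I C v c
        neighbours u∉ f (inj₁ refl , c∈) = contradiction c∈ u∉
        neighbours u∉ f (inj₂ a    , c∈) = inj₂ (f c∈ a) , c∈

      -- Compare the cells of both rows in one column `j`: a codeword lies in neither row, so it is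
      -- apart from either cell exactly when it avoids `j`. The nonempty code supplies some `j`.
      atMostOneEmptyRow : ∀ i i′ → EmptyRow xs i → EmptyRow xs i′ → i ≡ i′
      atMostOneEmptyRow i i′ e e′ with i ≟ i′
      ... | yes eq = eq
      ... | no  ne = ⊥-elim (conflict {i , j} {i′ , j}
        (λ c∈ → All.lookup e c∈ refl) (λ c∈ → All.lookup e′ c∈ refl) (ne ∘ cong proj₁)
        (λ { c∈ (_ , q) → All.lookup e′ c∈ , q }) (λ { c∈ (_ , q) → All.lookup e c∈ , q }))
        where j = proj₂ (proj₁ (element (Code.nonempty C)))

      atMostOneEmptyCol : ∀ j j′ → EmptyCol xs j → EmptyCol xs j′ → j ≡ j′
      atMostOneEmptyCol j j′ e e′ with j ≟ j′
      ... | yes eq = eq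
      ... | no  ne = ⊥-elim (conflict {i , j} {i , j′}
        (λ c∈ → All.lookup e c∈ refl) (λ c∈ → All.lookup e′ c∈ refl) (ne ∘ cong proj₂)
        (λ { c∈ (p , _) → p , All.lookup e′ c∈ }) (λ { c∈ (p , _) → p , All.lookup e c∈ }))
        where i = proj₁ (proj₁ (element (Code.nonempty C)))

      -- Two solo cells in one row (column) lie in empty columns (rows).  Two
      -- solo cells (i , j), (i′ , j′) in general position make (i , j′) and
      -- (i′ , j) indistinguishable.
      atMostOneSolo : ∀ u v → Solo xs u → Solo xs v → u ≡ v
      atMostOneSolo (i , j) (i′ , j′) s s′ with i ≟ i′ | j ≟ j′
      ... | yes refl | yes refl = refl
      ... | yes refl | no  j≢j′ = cong (i ,_) (atMostOneEmptyCol j j′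
        (All.tabulate λ c∈ q → j≢j′ (trans q (sym
          (cong proj₂ (All.lookup s′ c∈ (inj₁ (cong proj₁ (All.lookup s c∈ (inj₂ q)))))))))
        (All.tabulate λ c∈ q → j≢j′ (trans
          (cong proj₂ (All.lookup s c∈ (inj₁ (cong proj₁ (All.lookup s′ c∈ (inj₂ q)))))) (sym q))))
      ... | no  i≢i′ | yes refl = cong (_, j) (atMostOneEmptyRow i i′
        (All.tabulate λ c∈ p → i≢i′ (trans p (sym
          (cong proj₁ (All.lookup s′ c∈ (inj₂ (cong proj₂ (All.lookup s c∈ (inj₁ p)))))))))
        (All.tabulate λ c∈ p → i≢i′ (trans
          (cong proj₁ (All.lookup s c∈ (inj₂ (cong proj₂ (All.lookup s′ c∈ (inj₁ p)))))) (sym p))))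
      ... | no  i≢i′ | no  j≢j′ = ⊥-elim (conflict {i , j′} {i′ , j}
        (λ c∈ → j≢j′ (cong proj₂ (All.lookup s c∈ (inj₁ refl))))
        (λ c∈ → i≢i′ (cong proj₁ (All.lookup s c∈ (inj₂ refl))))
        (i≢i′ ∘ cong proj₁)
        (λ { c∈ (p , q) →
            (λ p′ → q (cong proj₂ (All.lookup s′ c∈ (inj₁ p′))))
          , (λ q′ → p (cong proj₁ (All.lookup s  c∈ (inj₂ q′)))) })
        (λ { c∈ (p , q) →
            (λ p′ → q (cong proj₂ (All.lookup s  c∈ (inj₁ p′))))
          , (λ q′ → p (cong proj₁ (All.lookup s′ c∈ (inj₂ q′)))) }))

    LD⇒locating : Locating xs
    LD⇒locating = locating atMostOneEmptyRow atMostOneEmptyCol atMostOneSolo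

  -- Suppose `u` and `v` have equal `I`-sets. If they share a row, a codeword in the column of one
  -- would be apart from the other only, so both columns are empty. In general position, a codeword
  -- in line with `(i , j′)` but different from it is apart from exactly one of `u` and `v`; hence
  -- `(i , j′)`, and likewise `(i′ , j)`, is solo.
  locating∧dominating⇒LD : Locating xs → Dominating xs → LocatingDominating C
  locating∧dominating⇒LD (locating rows cols solo) dom u@(i , j) v@(i′ , j′) u∉ v∉ u≢v =
    satisfiable (find (dom u v u∉ v∉ u≢v)) , distinguished
    where
    satisfiable : ∃[ c ] c ∈ xs × Apart u c → ∃[ c ] I C u c
    satisfiable (c , c∈ , a) = c , inj₂ a , c∈

    module _ (I⊆ : ∀ {c} → I C u c → I C v c) (I⊇ : ∀ {c} → I C v c → I C u c) where
      to : ∀ {c} → c ∈ xs → Apart u c → Apart v c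
      to c∈ a with proj₁ (I⊆ (inj₂ a , c∈))
      ... | inj₁ refl = contradiction c∈ v∉
      ... | inj₂ b    = b
      from : ∀ {c} → c ∈ xs → Apart v c → Apart u c
      from c∈ a with proj₁ (I⊇ (inj₂ a , c∈))
      ... | inj₁ refl = contradiction c∈ u∉
      ... | inj₂ b    = b

      u≡v : u ≡ v
      u≡v with i ≟ i′ | j ≟ j′
      ... | yes refl | yes refl = refl
      ... | yes refl | no  j≢j′ = cong (i ,_) (cols j j′
        (All.tabulate λ { c∈ refl → proj₂ (from c∈ ((λ { refl → u∉ c∈ }) , j≢j′ ∘ sym)) refl })
        (All.tabulate λ { c∈ refl → proj₂ (to   c∈ ((λ { refl → v∉ c∈ }) , j≢j′)) refl }))
      ... | no  i≢i′ | yes refl = cong (_, j) (rows i i′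
        (All.tabulate λ { c∈ refl → proj₁ (from c∈ (i≢i′ ∘ sym , (λ { refl → u∉ c∈ }))) refl })
        (All.tabulate λ { c∈ refl → proj₁ (to   c∈ (i≢i′ , (λ { refl → v∉ c∈ }))) refl }))
      ... | no  i≢i′ | no  j≢j′ = contradiction
        (cong proj₁ (solo (i , j′) (i′ , j)
          (All.tabulate λ
            { {_ , b} c∈ (inj₁ refl) → case j′ ≟ b of λ
                { (yes refl) → refl
                ; (no q) → contradiction refl (proj₁ (from c∈ (i≢i′ ∘ sym , q))) }
            ; {a , _} c∈ (inj₂ refl) → case i ≟ a of λ
                { (yes refl) → refl
                ; (no p) → contradiction refl (proj₂ (to c∈ (p , j≢j′))) } })
          (All.tabulate λ
            { {_ , b} c∈ (inj₁ refl) → case j ≟ b of λ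
                { (yes refl) → refl
                ; (no q) → contradiction refl (proj₁ (to c∈ (i≢i′ , q))) }
            ; {a , _} c∈ (inj₂ refl) → case i′ ≟ a of λ
                { (yes refl) → refl
                ; (no p) → contradiction refl (proj₂ (from c∈ (p , j≢j′ ∘ sym))) } }))) i≢i′

    distinguished : ¬ ((∀ {c} → I C u c → I C v c) × (∀ {c} → I C v c → I C u c))
    distinguished (I⊆ , I⊇) = u≢v (u≡v I⊆ I⊇)

-- Degrees of lines, double counting and discharging.

δ : Fin n → Fin n → ℕ
δ i j = if does (i ≟ j) then 1 else 0

δ-refl : (i : Fin n) → δ i i ≡ 1
δ-refl zero    = refl
δ-refl (suc i) = δ-refl i

δ-≢ : {i j : Fin n} → i ≢ j → δ i j ≡ 0
δ-≢ {i = i} {j} i≢j with i ≟ j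
... | yes i≡j = contradiction i≡j i≢j
... | no  _   = refl

-- For the list of rows (columns) of a code this is the degree of a line in the bipartite graph.
occ : Fin n → List (Fin n) → ℕ
occ i ys = List.sum (map (δ i) ys)

∈⇒occ≥1 : {i : Fin n} {ys : List (Fin n)} → i ∈ ys → 1 ≤ occ i ys
∈⇒occ≥1 {i = i} (here refl) rewrite δ-refl i = s≤s z≤n
∈⇒occ≥1 (there i∈) = ≤-trans (∈⇒occ≥1 i∈) (m≤n+m _ _)

occ≡0⇒∉ : (f : A → Fin n) {i : Fin n} {xs : List A} →
          occ i (map f xs) ≡ 0 → All (λ x → i ≢ f x) xs
occ≡0⇒∉ f occ≡0 = All.tabulate λ { x∈ refl → n≮0 (subst (1 ≤_) occ≡0 (∈⇒occ≥1 (∈-map⁺ f x∈))) }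

occ≥2 : (f : A → Fin n) {i : Fin n} {x y : A} {xs : List A} →
        i ≡ f x → i ≡ f y → y ∈ xs → 2 ≤ occ i (map f (x ∷ xs))
occ≥2 f {i} i≡fx refl y∈ rewrite sym i≡fx | δ-refl i = s≤s (∈⇒occ≥1 (∈-map⁺ f y∈))

occ≤1⇒unique : (f : A → Fin n) {i : Fin n} {x y : A} {xs : List A} → x ∈ xs → y ∈ xs →
               i ≡ f x → i ≡ f y → occ i (map f xs) ≤ 1 → x ≡ y
occ≤1⇒unique f (here refl) (here refl) _ _ _ = refl
occ≤1⇒unique f (here refl) (there y∈) p q occ≤1 = contradiction (occ≥2 f p q y∈) (<⇒≱ (s≤s occ≤1))
occ≤1⇒unique f (there x∈) (here refl) p q occ≤1 = contradiction (occ≥2 f q p x∈) (<⇒≱ (s≤s occ≤1))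
occ≤1⇒unique f (there x∈) (there y∈) p q occ≤1 =
  occ≤1⇒unique f x∈ y∈ p q (m+n≤o⇒n≤o _ occ≤1)

sum-δ : (f : Fin n → ℕ) (j : Fin n) → sum (λ i → δ i j * f i) ≡ f j
sum-δ {suc n} f zero =
  trans (cong₂ _+_ (+-identityʳ (f zero)) (sum-replicate-zero n)) (+-identityʳ (f zero))
sum-δ f (suc j) = sum-δ (f ∘ suc) j

-- Double counting: with `f` the share belonging to a line, the charge received by the lines is the
-- charge sent by the codewords.
sum-occ : (f : Fin n → ℕ) (ys : List (Fin n)) → sum (λ i → occ i ys * f i) ≡ List.sum (map f ys)
sum-occ {n} f [] = sum-replicate-zero n
sum-occ f (y ∷ ys) = begin
  sum (λ i → (δ i y + occ i ys) * f i)                   ≡⟨ sum-cong-≗ (λ i → *-distribʳ-+ (f i) (δ i y) (occ i ys)) ⟩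
  sum (λ i → δ i y * f i + occ i ys * f i)               ≡⟨ ∑-distrib-+ (λ i → δ i y * f i) _ ⟩
  sum (λ i → δ i y * f i) + sum (λ i → occ i ys * f i)   ≡⟨ cong₂ _+_ (sum-δ f y) (sum-occ f ys) ⟩
  f y + List.sum (map f ys)                              ∎
  where open ≡-Reasoning

sum-≥ : ∀ k (h : Fin n → ℕ) → (∀ i → k ≤ h i) → n * k ≤ sum h
sum-≥ {zero}  k h k≤h = z≤n
sum-≥ {suc n} k h k≤h = +-mono-≤ (k≤h zero) (sum-≥ k (h ∘ suc) (k≤h ∘ suc))

-- The summand `k` makes up for the one index that may fall short, whatever its value.
sum-≥-butOne : ∀ k (h : Fin n → ℕ) → (∀ i j → h i < k → h j < k → i ≡ j) → n * k ≤ sum h + k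
sum-≥-butOne {zero}  k h _ = z≤n
sum-≥-butOne {suc n} k h one with h zero <? k
... | yes h₀<k = begin
  k + n * k                     ≡⟨ +-comm k _ ⟩
  n * k + k                     ≤⟨ +-monoˡ-≤ k (sum-≥ k (h ∘ suc) (λ i → ≮⇒≥ (λ h<k → case one zero (suc i) h₀<k h<k of λ ()))) ⟩
  sum (h ∘ suc) + k             ≤⟨ +-monoˡ-≤ k (m≤n+m _ (h zero)) ⟩
  h zero + sum (h ∘ suc) + k    ∎
  where open ≤-Reasoning
... | no  h₀≮k = begin
  k + n * k                     ≤⟨ +-mono-≤ (≮⇒≥ h₀≮k) (sum-≥-butOne k (h ∘ suc) (λ i j p q → case one (suc i) (suc j) p q of λ { refl → refl })) ⟩
  h zero + (sum (h ∘ suc) + k)  ≡⟨ +-assoc (h zero) _ k ⟨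
  h zero + sum (h ∘ suc) + k    ∎
  where open ≤-Reasoning

-- Discharging: a codeword gives 2 to its row if it is alone there and 1
-- otherwise, so that every nonempty row receives at least 2.
share : ℕ → ℕ
share 1 = 2
share _ = 1

share≤2 : ∀ d → share d ≤ 2
share≤2 0             = s≤s z≤n
share≤2 1             = ≤-refl
share≤2 (suc (suc _)) = s≤s z≤n

share≥2⇒≡1 : ∀ d → 2 ≤ share d → d ≡ 1
share≥2⇒≡1 1 _ = refl
share≥2⇒≡1 0 (s≤s ())
share≥2⇒≡1 (suc (suc _)) (s≤s ())

d*share≥2 : ∀ d → d ≢ 0 → 2 ≤ d * share d
d*share≥2 0 d≢0 = contradiction refl d≢0
d*share≥2 1 _   = ≤-refl
d*share≥2 (suc (suc d)) _ = s≤s (s≤s z≤n)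

d*share<2⇒≡0 : ∀ d → d * share d < 2 → d ≡ 0
d*share<2⇒≡0 zero    _ = refl
d*share<2⇒≡0 (suc d) p = contradiction (d*share≥2 (suc d) λ ()) (<⇒≱ p)

module _ {f : A → ℕ} {k : ℕ} where

  sum-≤ : (xs : List A) → (∀ {x} → x ∈ xs → f x ≤ k) → List.sum (map f xs) ≤ length xs * k
  sum-≤ []       _   = z≤n
  sum-≤ (x ∷ xs) f≤k = +-mono-≤ (f≤k (here refl)) (sum-≤ xs (f≤k ∘ there))

  sum-≥-list : (xs : List A) → (∀ {x} → x ∈ xs → k ≤ f x) → length xs * k ≤ List.sum (map f xs)
  sum-≥-list []       _   = z≤n
  sum-≥-list (x ∷ xs) k≤f = +-mono-≤ (k≤f (here refl)) (sum-≥-list xs (k≤f ∘ there))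

  sum-< : {z : A} {xs : List A} → (∀ {x} → x ∈ xs → f x ≤ k) → z ∈ xs → f z < k →
          List.sum (map f xs) < length xs * k
  sum-< f≤k (here {xs = xs} refl) fz<k = +-mono-<-≤ fz<k (sum-≤ xs (f≤k ∘ there))
  sum-< f≤k (there z∈)            fz<k = +-mono-≤-< (f≤k (here refl)) (sum-< (f≤k ∘ there) z∈ fz<k)

  -- Meant for `k = 3`: the extra 1 is spent on a single codeword of weight 4, and distinctness
  -- keeps that codeword from being counted again.
  sum-≤-butOne : {xs : List A} → (∀ x → f x ≤ suc k) → Unique xs →
                 (∀ {x y} → x ∈ xs → y ∈ xs → k < f x → k < f y → x ≡ y) →
                 List.sum (map f xs) ≤ length xs * k + 1
  sum-≤-butOne _ [] _ = z≤n
  sum-≤-butOne {x ∷ xs} f≤1+k (x∉ ∷ unique) one with k <? f x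
  ... | yes k<fx = begin
    f x + List.sum (map f xs)    ≤⟨ +-mono-≤ (f≤1+k x) (sum-≤ xs λ y∈ → ≮⇒≥ λ k<fy →
                                      All.lookup x∉ y∈ (one (here refl) (there y∈) k<fx k<fy)) ⟩
    suc k + length xs * k        ≡⟨ +-comm 1 _ ⟩
    k + length xs * k + 1        ∎
    where open ≤-Reasoning
  ... | no  k≮fx = begin
    f x + List.sum (map f xs)    ≤⟨ +-mono-≤ (≮⇒≥ k≮fx) (sum-≤-butOne f≤1+k unique λ x∈ y∈ → one (there x∈) (there y∈)) ⟩
    k + (length xs * k + 1)      ≡⟨ +-assoc k _ 1 ⟨
    k + length xs * k + 1        ∎
    where open ≤-Reasoning

sum-+ : (f g : A → ℕ) (xs : List A) →
        List.sum (map (λ x → f x + g x) xs) ≡ List.sum (map f xs) + List.sum (map g xs)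
sum-+ f g [] = refl
sum-+ f g (x ∷ xs) = trans (cong (f x + g x +_) (sum-+ f g xs)) (lemma (f x) (g x) _ _)
  where
  lemma : ∀ a b c d → a + b + (c + d) ≡ a + c + (b + d)
  lemma = solve-∀

-- The total charge that a code sends to its rows (columns).
shareSum : List (Fin n) → ℕ
shareSum ys = List.sum (map (λ y → share (occ y ys)) ys)

shareSum-full : (ys : List (Fin n)) → (∀ i → occ i ys ≢ 0) → n * 2 ≤ shareSum ys
shareSum-full {n} ys full = subst (n * 2 ≤_) (sum-occ _ ys)
  (sum-≥ 2 (λ i → occ i ys * share (occ i ys)) (λ i → d*share≥2 _ (full i)))

-- An empty line receives nothing, and the 2 makes up for the only one there can be.
shareSum-butOne : (ys : List (Fin n)) → (∀ i j → occ i ys ≡ 0 → occ j ys ≡ 0 → i ≡ j) →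
                  n * 2 ≤ shareSum ys + 2
shareSum-butOne {n} ys one = subst (λ s → n * 2 ≤ s + 2) (sum-occ _ ys)
  (sum-≥-butOne 2 (λ i → occ i ys * share (occ i ys))
    (λ i j p q → one i j (d*share<2⇒≡0 _ p) (d*share<2⇒≡0 _ q)))

-- The same count with charge 1 per codeword in place of shares; it leads to `m ≤ e + 1`.
length-butOne : (ys : List (Fin n)) → (∀ i j → occ i ys ≡ 0 → occ j ys ≡ 0 → i ≡ j) →
                n ≤ length ys + 1
length-butOne {n} ys one = begin
  n                                    ≡⟨ *-identityʳ n ⟨
  n * 1                                ≤⟨ sum-≥-butOne 1 (λ i → occ i ys * 1) (λ i j p q → one i j (zeroAt i p) (zeroAt j q)) ⟩
  sum (λ i → occ i ys * 1) + 1         ≡⟨ cong (_+ 1) (sum-occ (λ _ → 1) ys) ⟩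
  List.sum (map (λ _ → 1) ys) + 1      ≤⟨ +-monoˡ-≤ 1 (sum-≤ ys (λ _ → ≤-refl)) ⟩
  length ys * 1 + 1                    ≡⟨ cong (_+ 1) (*-identityʳ _) ⟩
  length ys + 1                        ∎
  where
  open ≤-Reasoning
  zeroAt : ∀ i → occ i ys * 1 < 1 → occ i ys ≡ 0
  zeroAt i p = n<1⇒n≡0 (subst (_< 1) (*-identityʳ _) p)

-- Lower bounds on the size, and the exceptional pair (4 , 4).

module LowerBounds {xs : List (Cell n m)} (loc : Locating xs) where

  open Locating loc

  rows = map proj₁ xs
  cols = map proj₂ xs

  rowShare colShare weight : Cell n m → ℕ
  rowShare c = share (occ (proj₁ c) rows)
  colShare c = share (occ (proj₂ c) cols)
  weight   c = rowShare c + colShare c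

  weights : List.sum (map weight xs) ≡ shareSum rows + shareSum cols
  weights = trans (sum-+ rowShare colShare xs)
    (cong₂ (λ a b → List.sum a + List.sum b) (map-∘ xs) (map-∘ xs))

  emptyRow : ∀ {i} → occ i rows ≡ 0 → EmptyRow xs i
  emptyRow = occ≡0⇒∉ proj₁

  emptyCol : ∀ {j} → occ j cols ≡ 0 → EmptyCol xs j
  emptyCol = occ≡0⇒∉ proj₂

  rowOne : ∀ i i′ → occ i rows ≡ 0 → occ i′ rows ≡ 0 → i ≡ i′
  rowOne i i′ p q = oneEmptyRow i i′ (emptyRow p) (emptyRow q)

  colOne : ∀ j j′ → occ j cols ≡ 0 → occ j′ cols ≡ 0 → j ≡ j′
  colOne j j′ p q = oneEmptyCol j j′ (emptyCol p) (emptyCol q)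

  columns-≤ : m ≤ length xs + 1
  columns-≤ = subst (λ l → m ≤ l + 1) (length-map proj₂ xs) (length-butOne cols colOne)

  weight≤4 : ∀ c → weight c ≤ 4
  weight≤4 c = +-mono-≤ (share≤2 (occ (proj₁ c) rows)) (share≤2 (occ (proj₂ c) cols))

  -- Each share is at most 2, so both equal 2, and the row and the column of `c` have degree 1.
  weight>3⇒solo : ∀ {c} → c ∈ xs → 3 < weight c → Solo xs c
  weight>3⇒solo {c} c∈ w>3 = All.tabulate λ
    { d∈ (inj₁ p) → occ≤1⇒unique proj₁ c∈ d∈ refl p (≤-reflexive (share≥2⇒≡1 _ rowShare≥2))
    ; d∈ (inj₂ q) → occ≤1⇒unique proj₂ c∈ d∈ refl q (≤-reflexive (share≥2⇒≡1 _ colShare≥2)) }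
    where
    rowShare≥2 : 2 ≤ rowShare c
    rowShare≥2 = +-cancelʳ-≤ 2 2 _ (≤-trans w>3 (+-monoʳ-≤ (rowShare c) (share≤2 (occ (proj₂ c) cols))))
    colShare≥2 : 2 ≤ colShare c
    colShare≥2 = +-cancelˡ-≤ 2 2 _ (≤-trans w>3 (+-monoˡ-≤ (colShare c) (share≤2 (occ (proj₁ c) rows))))

  -- The crossing of the two empty lines is already solo, and a codeword of weight 4 would be a
  -- second solo cell.
  weight≤3 : ∀ {i j} → EmptyRow xs i → EmptyCol xs j → ∀ {c} → c ∈ xs → weight c ≤ 3
  weight≤3 {i} {j} er ec {c} c∈ = ≮⇒≥ λ w>3 → All.lookup er c∈ (cong proj₁
    (oneSolo (i , j) c crossing (weight>3⇒solo c∈ w>3)))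
    where
    crossing : Solo xs (i , j)
    crossing = All.tabulate λ
      { d∈ (inj₁ p) → contradiction p (All.lookup er d∈)
      ; d∈ (inj₂ q) → contradiction q (All.lookup ec d∈) }

  module _ (unique : Unique xs) where

    shares≤ : shareSum rows + shareSum cols ≤ length xs * 3 + 1
    shares≤ = subst (_≤ length xs * 3 + 1) weights
      (sum-≤-butOne weight≤4 unique λ x∈ y∈ p q →
        oneSolo _ _ (weight>3⇒solo x∈ p) (weight>3⇒solo y∈ q))

    private
      full+butOne : ∀ {a b s t u} → a ≤ s → b ≤ t + 2 → s + t ≤ u + 1 → a + b ≤ u + 3
      full+butOne {a} {b} {s} {t} {u} a≤s b≤t+2 s+t≤u+1 = begin
        a + b          ≤⟨ +-mono-≤ a≤s b≤t+2 ⟩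
        s + (t + 2)    ≡⟨ +-assoc s t 2 ⟨
        s + t + 2      ≤⟨ +-monoˡ-≤ 2 s+t≤u+1 ⟩
        u + 1 + 2      ≡⟨ +-assoc u 1 2 ⟩
        u + 3          ∎
        where open ≤-Reasoning

    -- If one direction has no empty line, the loss is at most 2 for an empty line in the other
    -- direction and 1 for a solo codeword.
    emptyLines⊎surplus : (∃[ i ] EmptyRow xs i) × (∃[ j ] EmptyCol xs j) ⊎
                         n * 2 + m * 2 ≤ length xs * 3 + 3
    emptyLines⊎surplus with any? (λ i → occ i rows ≟ℕ 0) | any? (λ j → occ j cols ≟ℕ 0)
    ... | yes (i , p) | yes (j , q) = inj₁ ((i , emptyRow p) , (j , emptyCol q))
    ... | no ¬p       | _           = inj₂
      (full+butOne (shareSum-full rows λ i p → ¬p (i , p)) (shareSum-butOne cols colOne) shares≤)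
    ... | yes _       | no ¬q       = inj₂ (subst (_≤ length xs * 3 + 3) (+-comm (m * 2) (n * 2))
      (full+butOne (shareSum-full cols λ j q → ¬q (j , q)) (shareSum-butOne rows rowOne)
        (subst (_≤ length xs * 3 + 1) (+-comm (shareSum rows) _) shares≤)))

    shares≤′ : ∀ {i j} → EmptyRow xs i → EmptyCol xs j → shareSum rows + shareSum cols ≤ length xs * 3
    shares≤′ er ec = subst (_≤ length xs * 3) weights (sum-≤ xs (weight≤3 er ec))

    -- An empty row and an empty column lose 2 each, but their crossing rules out the extra 1 of a
    -- solo codeword.
    lines-≤ : n * 2 + m * 2 ≤ length xs * 3 + 4
    lines-≤ with emptyLines⊎surplus
    ... | inj₂ surplus = ≤-trans surplus (+-monoʳ-≤ (length xs * 3) (n≤1+n 3))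
    ... | inj₁ ((_ , er) , (_ , ec)) = begin
      n * 2 + m * 2                              ≤⟨ +-mono-≤ (shareSum-butOne rows rowOne) (shareSum-butOne cols colOne) ⟩
      shareSum rows + 2 + (shareSum cols + 2)    ≡⟨ lemma (shareSum rows) (shareSum cols) ⟩
      shareSum rows + shareSum cols + 4          ≤⟨ +-monoˡ-≤ 4 (shares≤′ er ec) ⟩
      length xs * 3 + 4                          ∎
      where
      open ≤-Reasoning
      lemma : ∀ a b → a + 2 + (b + 2) ≡ a + b + 4
      lemma = solve-∀

-- Equality holds in lines-≤, so no codeword has a second codeword both in its
-- row and in its column.  A row and a column with two codewords each therefore
-- cross outside the code, and together contain all four codewords.
fourByFour : {xs : List (Cell 4 4)} → Unique xs → Locating xs → length xs ≡ 4 → ¬ Dominating xs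
fourByFour {xs} unique loc len dom
  with emptyLines⊎surplus unique
  where open LowerBounds loc
-- Four codewords would give `16 ≤ 4 * 3 + 3`, so an empty row and an empty column both exist.
... | inj₂ surplus rewrite len = contradiction surplus (from-no (16 ≤? 15))
... | inj₁ ((i₀ , er) , (j₀ , ec)) = crowded (find (dom (r , c) (i₀ , c) rc∉ i₀c∉ (r≢i₀ ∘ cong proj₁)))
  where
  open LowerBounds loc

  6≤R : 6 ≤ shareSum rows
  6≤R = +-cancelʳ-≤ 2 6 _ (shareSum-butOne rows rowOne)

  6≤S : 6 ≤ shareSum cols
  6≤S = +-cancelʳ-≤ 2 6 _ (shareSum-butOne cols colOne)

  R+S≤12 : shareSum rows + shareSum cols ≤ 12
  R+S≤12 = subst (λ l → shareSum rows + shareSum cols ≤ l * 3) len (shares≤′ unique er ec)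

  R<8 : shareSum rows < 8
  R<8 = s≤s (≤-trans (+-cancelʳ-≤ 6 _ 6 (≤-trans (+-monoʳ-≤ (shareSum rows) 6≤S) R+S≤12)) (n≤1+n 6))

  S<8 : shareSum cols < 8
  S<8 = s≤s (≤-trans (+-cancelˡ-≤ 6 _ 6 (≤-trans (+-monoˡ-≤ (shareSum cols) 6≤R) R+S≤12)) (n≤1+n 6))

  -- If every share were 2, they would add up to 8.
  busy : (f : Cell 4 4 → Fin 4) → shareSum (map f xs) < 8 →
         ∃[ x ] x ∈ xs × share (occ (f x) (map f xs)) < 2
  busy f R<8 with Any.any? (λ x → share (occ (f x) (map f xs)) <? 2) xs
  ... | yes p = find p
  ... | no ¬p = contradiction
    (subst₂ _≤_ (cong (_* 2) len) (cong List.sum (map-∘ xs))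
      (sum-≥-list xs λ x∈ → ≮⇒≥ λ q → ¬p (lose x∈ q)))
    (<⇒≱ R<8)

  x = busy proj₁ R<8
  y = busy proj₂ S<8
  r = proj₁ (proj₁ x)
  c = proj₂ (proj₁ y)
  r∈ = ∈-map⁺ proj₁ (proj₁ (proj₂ x))
  c∈ = ∈-map⁺ proj₂ (proj₁ (proj₂ y))

  share<2⇒≥2 : ∀ d → 1 ≤ d → share d < 2 → 2 ≤ d
  share<2⇒≥2 1 _ (s≤s (s≤s ()))
  share<2⇒≥2 (suc (suc _)) _ _ = s≤s (s≤s z≤n)

  -- As a codeword, `(r , c)` would have weight at most 2 and pull the total below 12, while rows
  -- and columns receive at least 6 each.
  rc∉ : (r , c) ∉ xs
  rc∉ rc∈ = contradiction (+-mono-≤ 6≤R 6≤S) (<⇒≱ (subst₂ _<_ weights (cong (_* 3) len)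
    (sum-< (weight≤3 er ec) rc∈ (s≤s (+-mono-≤ (≤-pred (proj₂ (proj₂ x))) (≤-pred (proj₂ (proj₂ y))))))))

  r≢i₀ : r ≢ i₀
  r≢i₀ eq = All.lookup er (proj₁ (proj₂ x)) (sym eq)

  i₀c∉ : (i₀ , c) ∉ xs
  i₀c∉ ∈xs = All.lookup er ∈xs refl

  hits : Cell 4 4 → ℕ
  hits z = δ r (proj₁ z) + δ c (proj₂ z)

  hits≤1 : ∀ {z} → z ∈ xs → hits z ≤ 1
  hits≤1 {i , j} z∈ with r ≟ i | c ≟ j
  ... | yes refl | yes refl = contradiction z∈ rc∉
  ... | yes _    | no  _    = ≤-refl
  ... | no  _    | yes _    = ≤-refl
  ... | no  _    | no  _    = z≤n

  -- Row `r` and column `c` have degree at least 2 each, so the four codewords make at least 4 hits.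
  -- Each makes at most one, as the crossing is no codeword, so none of them can miss both lines.
  crowded : ∃[ z ] z ∈ xs × Apart (r , c) z → ⊥
  crowded (z , z∈ , (p , q)) = contradiction
    (+-mono-≤ (share<2⇒≥2 _ (∈⇒occ≥1 r∈) (proj₂ (proj₂ x))) (share<2⇒≥2 _ (∈⇒occ≥1 c∈) (proj₂ (proj₂ y))))
    (<⇒≱ (subst₂ _<_ total (cong (_* 1) len)
      (sum-< hits≤1 z∈ (≤-reflexive (cong suc (cong₂ _+_ (δ-≢ p) (δ-≢ q)))))))
    where
    total : List.sum (map hits xs) ≡ occ r rows + occ c cols
    total = trans (sum-+ (δ r ∘ proj₁) (δ c ∘ proj₂) xs)
      (cong₂ (λ a b → List.sum a + List.sum b) (map-∘ xs) (map-∘ xs))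

-- Decision procedures for explicit codes.

module _ {n m : ℕ} where

  open DecMembership (_≟ᶜ_ {n} {m}) using (_∈?_; _∉?_)

  allCells? : {P : Cell n m → Set} → Decidable P → Dec (∀ u → P u)
  allCells? P? = map′ uncurry curry (all? λ i → all? λ j → P? (i , j))

  locating? : (xs : List (Cell n m)) → Dec (Locating xs)
  locating? xs = map′ (λ (r , c , s) → locating r c s)
    (λ (locating r c s) → r , c , s)
    ((all? λ i → all? λ i′ → emptyRow? i →-dec emptyRow? i′ →-dec i ≟ i′) ×-dec
     (all? λ j → all? λ j′ → emptyCol? j →-dec emptyCol? j′ →-dec j ≟ j′) ×-dec
     (allCells? λ u → allCells? λ v → solo? u →-dec solo? v →-dec u ≟ᶜ v))
    where
    emptyRow? = λ i → All.all? (λ c → ¬? (i ≟ proj₁ c)) xs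
    emptyCol? = λ j → All.all? (λ c → ¬? (j ≟ proj₂ c)) xs
    solo?     = λ u → All.all? (λ c → (proj₁ u ≟ proj₁ c ⊎-dec proj₂ u ≟ proj₂ c) →-dec u ≟ᶜ c) xs

  apart? : (u : Cell n m) → Decidable (Apart u)
  apart? u c = ¬? (proj₁ u ≟ proj₁ c) ×-dec ¬? (proj₂ u ≟ proj₂ c)

  dominating? : (xs : List (Cell n m)) → Dec (Dominating xs)
  dominating? xs = allCells? λ u → allCells? λ v →
    u ∉? xs →-dec v ∉? xs →-dec ¬? (u ≟ᶜ v) →-dec Any.any? (apart? u) xs

-- In contrast to Dominating, the two fields about lines rule out codes inside
-- a single row or column, which makes the notion stable under extension.
record Robust (xs : List (Cell n m)) : Set where
  constructor robust
  field
    nonempty   : xs ≢ []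
    isLocating : Locating xs
    unique     : Unique xs
    covers     : ∀ u → u ∈ xs ⊎ Any (Apart u) xs
    offRow     : ∀ i → Any (λ c → i ≢ proj₁ c) xs
    offCol     : ∀ j → Any (λ c → j ≢ proj₂ c) xs

robust? : (xs : List (Cell n m)) → Dec (Robust xs)
robust? []         = no λ r → Robust.nonempty r refl
robust? xs@(_ ∷ _) = map′ (λ (a , b , c , d , e) → robust (λ ()) a b c d e)
  (λ (robust _ a b c d e) → a , b , c , d , e)
  (locating? xs ×-dec unique? _≟ᶜ_ xs ×-dec
   allCells? (λ u → u ∈? xs ⊎-dec Any.any? (apart? u) xs) ×-dec
   all? (λ i → Any.any? (λ c → ¬? (i ≟ proj₁ c)) xs) ×-dec
   all? (λ j → Any.any? (λ c → ¬? (j ≟ proj₂ c)) xs))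
  where open DecMembership _≟ᶜ_ using (_∈?_)

-- Moves that extend robust codes.

RobustCode : ℕ → ℕ → ℕ → Set
RobustCode n m e = ∃[ xs ] Robust {n} {m} xs × length xs ≡ e

transposeCode : RobustCode n m e → RobustCode m n e
transposeCode (xs , robust nonempty (locating rows cols solo) unique covers offRow offCol , len) =
  map swap xs ,
  robust
    (nonempty ∘ map-injective (cong swap))
    (locating
      (λ j j′ p q → cols j j′ (All.map⁻ p) (All.map⁻ q))
      (λ i i′ p q → rows i i′ (All.map⁻ p) (All.map⁻ q))
      (λ u v p q → cong swap (solo (swap u) (swap v) (swapSolo p) (swapSolo q))))
    (Unique.map⁺ (cong swap) unique)
    (λ u → Sum.map (∈-map⁺ swap) (Any.map⁺ ∘ Any.map swap) (covers (swap u)))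
    (Any.map⁺ ∘ offCol)
    (Any.map⁺ ∘ offRow) ,
  trans (length-map swap xs) len
  where
  swapSolo : ∀ {u} → Solo (map swap xs) u → Solo xs (swap u)
  swapSolo s = All.map (λ f → cong swap ∘ f ∘ Sum.swap) (All.map⁻ s)

-- The new codewords share row 0, and every new line contains one of them, so all empty lines and
-- solo cells come from the old code. The non-codewords of row 0 are covered through `offCol`, all
-- cells of the other rows by one of the two new codewords.
addRowStar : RobustCode n m e → RobustCode (1 + n) (2 + m) (2 + e)
addRowStar {n} {m} (xs , robust nonempty (locating rows cols solo) unique covers offRow offCol , len) =
  ys ,
  robust (λ ()) (locating rows′ cols′ solo′) unique′ covers′ offRow′ offCol′ ,
  cong (2 +_) (trans (length-map shift xs) len)
  where
  shift : Cell n m → Cell (1 + n) (2 + m)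
  shift (i , j) = suc i , suc (suc j)

  shift-injective : ∀ {u v} → shift u ≡ shift v → u ≡ v
  shift-injective refl = refl

  ss : Fin m → Fin (2 + m)
  ss j = suc (suc j)

  ys = (zero , zero) ∷ (zero , suc zero) ∷ map shift xs

  rows′ : ∀ i i′ → EmptyRow ys i → EmptyRow ys i′ → i ≡ i′
  rows′ zero    _        (p ∷ _) _ = contradiction refl p
  rows′ (suc _) zero     _ (q ∷ _) = contradiction refl q
  rows′ (suc i) (suc i′) (_ ∷ _ ∷ p) (_ ∷ _ ∷ q) =
    cong suc (rows i i′ (All.map (_∘ cong suc) (All.map⁻ p)) (All.map (_∘ cong suc) (All.map⁻ q)))

  emptyCol⁻ : ∀ {j} → EmptyCol ys j → ∃[ k ] j ≡ suc (suc k) × EmptyCol xs k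
  emptyCol⁻ {zero}        (p ∷ _)     = contradiction refl p
  emptyCol⁻ {suc zero}    (_ ∷ p ∷ _) = contradiction refl p
  emptyCol⁻ {suc (suc k)} (_ ∷ _ ∷ p) = k , refl , All.map (_∘ cong ss) (All.map⁻ p)

  cols′ : ∀ j j′ → EmptyCol ys j → EmptyCol ys j′ → j ≡ j′
  cols′ j j′ p q with emptyCol⁻ p | emptyCol⁻ q
  ... | k , refl , p′ | k′ , refl , q′ = cong ss (cols k k′ p′ q′)

  solo⁻ : ∀ {u} → Solo ys u → ∃[ v ] u ≡ shift v × Solo xs v
  -- A solo cell in row 0 would have to equal both new codewords.
  solo⁻ {zero , j} (p ∷ q ∷ _) with refl ← p (inj₁ refl) = case q (inj₁ refl) of λ ()
  solo⁻ {suc i , zero}     (p ∷ _)     = case p (inj₂ refl) of λ ()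
  solo⁻ {suc i , suc zero} (_ ∷ q ∷ _) = case q (inj₂ refl) of λ ()
  solo⁻ {suc i , suc (suc j)} (_ ∷ _ ∷ s) = (i , j) , refl ,
    All.map (λ f → shift-injective ∘ f ∘ Sum.map (cong suc) (cong ss)) (All.map⁻ s)

  solo′ : ∀ u v → Solo ys u → Solo ys v → u ≡ v
  solo′ u v p q with solo⁻ p | solo⁻ q
  ... | u′ , refl , p′ | v′ , refl , q′ = cong shift (solo u′ v′ p′ q′)

  unique′ : Unique ys
  unique′ = ((λ ()) ∷ All.map⁺ (All.tabulate λ _ ())) ∷ All.map⁺ (All.tabulate λ _ ()) ∷
            Unique.map⁺ shift-injective unique

  covers′ : ∀ u → u ∈ ys ⊎ Any (Apart u) ys
  covers′ (zero , zero)     = inj₁ (here refl)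
  covers′ (zero , suc zero) = inj₁ (there (here refl))
  covers′ (zero , suc (suc j)) = inj₂ (there (there (Any.map⁺
    (Any.map (λ p → (λ ()) , p ∘ suc-injective ∘ suc-injective) (offCol j)))))
  covers′ (suc i , zero)        = inj₂ (there (here ((λ ()) , λ ())))
  covers′ (suc i , suc zero)    = inj₂ (here ((λ ()) , λ ()))
  covers′ (suc i , suc (suc j)) = inj₂ (here ((λ ()) , λ ()))

  offRow′ : ∀ i → Any (λ c → i ≢ proj₁ c) ys
  offRow′ zero    = there (there (lose (∈-map⁺ shift (proj₂ (element nonempty))) λ ()))
  offRow′ (suc i) = here λ ()

  offCol′ : ∀ j → Any (λ c → j ≢ proj₂ c) ys
  offCol′ zero    = there (here λ ())
  offCol′ (suc j) = here λ ()

-- The new leaf joins the row of an old codeword `c₀`. Hence it is not solo, the same rows stay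
-- empty, and old solo cells can only be lost. The rest of the new column is covered through
-- `offRow`.
addColumn : RobustCode n m e → RobustCode n (1 + m) (1 + e)
addColumn {n} {m} (xs , robust nonempty (locating rows cols solo) unique covers offRow offCol , len) =
  ys ,
  robust (λ ()) (locating rows′ cols′ solo′) unique′ covers′ offRow′ offCol′ ,
  cong suc (trans (length-map shift xs) len)
  where
  shift : Cell n m → Cell n (1 + m)
  shift (i , j) = i , suc j

  shift-injective : ∀ {u v} → shift u ≡ shift v → u ≡ v
  shift-injective refl = refl

  c₀ = proj₁ (element nonempty)

  c₀∈ : shift c₀ ∈ map shift xs
  c₀∈ = ∈-map⁺ shift (proj₂ (element nonempty))

  ys = (proj₁ c₀ , zero) ∷ map shift xs

  rows′ : ∀ i i′ → EmptyRow ys i → EmptyRow ys i′ → i ≡ i′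
  rows′ i i′ (_ ∷ p) (_ ∷ q) = rows i i′ (All.map⁻ p) (All.map⁻ q)

  cols′ : ∀ j j′ → EmptyCol ys j → EmptyCol ys j′ → j ≡ j′
  cols′ zero    _        (p ∷ _) _ = contradiction refl p
  cols′ (suc _) zero     _ (q ∷ _) = contradiction refl q
  cols′ (suc j) (suc j′) (_ ∷ p) (_ ∷ q) =
    cong suc (cols j j′ (All.map (_∘ cong suc) (All.map⁻ p)) (All.map (_∘ cong suc) (All.map⁻ q)))

  solo⁻ : ∀ {u} → Solo ys u → ∃[ v ] u ≡ shift v × Solo xs v
  solo⁻ {i , zero} (p ∷ s) with refl ← p (inj₂ refl) = case All.lookup s c₀∈ (inj₁ refl) of λ ()
  solo⁻ {i , suc j} (_ ∷ s) = (i , j) , refl ,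
    All.map (λ f → shift-injective ∘ f ∘ Sum.map₂ (cong suc)) (All.map⁻ s)

  solo′ : ∀ u v → Solo ys u → Solo ys v → u ≡ v
  solo′ u v p q with solo⁻ p | solo⁻ q
  ... | u′ , refl , p′ | v′ , refl , q′ = cong shift (solo u′ v′ p′ q′)

  unique′ : Unique ys
  unique′ = All.map⁺ (All.tabulate λ _ ()) ∷ Unique.map⁺ shift-injective unique

  covers′ : ∀ u → u ∈ ys ⊎ Any (Apart u) ys
  covers′ (i , zero) with i ≟ proj₁ c₀
  ... | yes refl = inj₁ (here refl)
  ... | no  _    = inj₂ (there (Any.map⁺ (Any.map (_, λ ()) (offRow i))))
  covers′ (i , suc j) = Sum.map (there ∘ ∈-map⁺ shift)
    (there ∘ Any.map⁺ ∘ Any.map (Product.map₂ (_∘ suc-injective))) (covers (i , j))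

  offRow′ : ∀ i → Any (λ c → i ≢ proj₁ c) ys
  offRow′ i = there (Any.map⁺ (offRow i))

  offCol′ : ∀ j → Any (λ c → j ≢ proj₂ c) ys
  offCol′ zero    = there (lose c₀∈ λ ())
  offCol′ (suc j) = here λ ()

-- Small codes and the families grown from them.

base : (xs : List (Cell n m)) {_ : True (robust? xs)} → RobustCode n m (length xs)
base xs {r} = xs , toWitness r , refl

-- Two stars centred at rows, and one empty column; here `m = 2 * n + 1`.
base₂₅ : RobustCode 2 5 4
base₂₅ = base ((# 0 , # 0) ∷ (# 0 , # 1) ∷ (# 1 , # 2) ∷ (# 1 , # 3) ∷ [])

-- A path with three edges; the empty row and the empty column cross in its only solo cell.
base₃₃ : RobustCode 3 3 3
base₃₃ = base ((# 0 , # 0) ∷ (# 0 , # 1) ∷ (# 1 , # 1) ∷ [])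

base₃₄ : RobustCode 3 4 4
base₃₄ = base ((# 0 , # 0) ∷ (# 0 , # 1) ∷ (# 1 , # 1) ∷ (# 1 , # 2) ∷ [])

base₃₅ : RobustCode 3 5 4
base₃₅ = base ((# 0 , # 0) ∷ (# 0 , # 1) ∷ (# 1 , # 2) ∷ (# 1 , # 3) ∷ [])

-- The isolated edge `(2 , 4)` is the only solo cell: a column is empty, but no row is.
base₃₆ : RobustCode 3 6 5
base₃₆ = base ((# 0 , # 0) ∷ (# 0 , # 1) ∷ (# 1 , # 2) ∷ (# 1 , # 3) ∷ (# 2 , # 4) ∷ [])

addColumns : ∀ k → RobustCode n m e → RobustCode n (k + m) (k + e)
addColumns zero    C = C
addColumns (suc k) C = addColumn (addColumns k C)

addRowStars : ∀ k → RobustCode n m e → RobustCode (k + n) (k * 2 + m) (k * 2 + e)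
addRowStars zero    C = C
addRowStars (suc k) C = addRowStar (addRowStars k C)

addColStar : RobustCode n m e → RobustCode (2 + n) (1 + m) (2 + e)
addColStar = transposeCode ∘ addRowStar ∘ transposeCode

-- Row stars preserve `m - 2 * n`. The pairs with `m = 2 * n` start from `base₃₆`, as `(2 , 4)` is
-- excluded. For `m > 2 * n`, row stars on `base₂₅` reach `m = 2 * n + 1`, and single columns supply
-- the rest.
wideCode : ∀ n m → 2 ≤ n → 2 * n ≤ m → (n , m) ≢ (2 , 4) →
           ∃[ e ] m ≡ suc e × RobustCode n m e
wideCode n m 2≤n 2n≤m ≢24 with m≤n⇒∃[o]m+o≡n 2≤n | m≤n⇒∃[o]m+o≡n 2n≤m
... | zero , refl | zero , refl = contradiction refl ≢24
... | suc p , refl | zero , refl =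
  p * 2 + 5 , trans (width p) (+-suc (p * 2) 5) ,
  subst₂ (λ n m → RobustCode n m (p * 2 + 5)) (height p) (sym (width p)) (addRowStars p base₃₆)
  where
  height : ∀ p → p + 3 ≡ 2 + suc p
  height = solve-∀
  width : ∀ p → 2 * (2 + suc p) + 0 ≡ p * 2 + 6
  width = solve-∀
... | p , refl | suc c , refl =
  c + (p * 2 + 4) , trans (width p c) (lemma p c) ,
  subst₂ (λ n m → RobustCode n m (c + (p * 2 + 4))) (+-comm p 2) (sym (width p c))
    (addColumns c (addRowStars p base₂₅))
  where
  width : ∀ p c → 2 * (2 + p) + suc c ≡ c + (p * 2 + 5)
  width = solve-∀
  lemma : ∀ p c → c + (p * 2 + 5) ≡ suc (c + (p * 2 + 4))
  lemma = solve-∀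

-- The size e is ⌊ (2 * n + 2 * m ∸ 2) / 3 ⌋, with remainder d.
BalancedCode : ℕ → ℕ → Set
BalancedCode n m = ∃[ e ] RobustCode n m e × ∃[ d ] d < 3 × 2 * n + 2 * m ≡ e * 3 + d + 2

-- Both `2 * n + 2 * m` and `e * 3` grow by 6, so the remainder `d` survives.
balancedRowStar : BalancedCode n m → BalancedCode (1 + n) (2 + m)
balancedRowStar {n} {m} (e , C , d , d<3 , eq) = 2 + e , addRowStar C , d , d<3 ,
  trans (lemma n m) (cong (6 +_) eq)
  where
  lemma : ∀ n m → 2 * (1 + n) + 2 * (2 + m) ≡ 6 + (2 * n + 2 * m)
  lemma = solve-∀

balancedColStar : BalancedCode n m → BalancedCode (2 + n) (1 + m)
balancedColStar {n} {m} (e , C , d , d<3 , eq) = 2 + e , addColStar C , d , d<3 ,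
  trans (lemma n m) (cong (6 +_) eq)
  where
  lemma : ∀ n m → 2 * (2 + n) + 2 * (1 + m) ≡ 6 + (2 * n + 2 * m)
  lemma = solve-∀

-- Here `n = 3 + p` and `a` is the excess `m - n`. A row star raises the excess by 1 and a column
-- star lowers it by 1. From `p = 2` on, the last star is a column star if `a ≤ 1` and a row star
-- otherwise, so that the smaller code always has positive excess and avoids `(4 , 4)`.
balancedCode : ∀ p a → a ≤ 2 + p → ¬ (p ≡ 1 × a ≡ 0) → BalancedCode (3 + p) (3 + p + a)
balancedCode 0 0 _ _ = 3 , base₃₃ , 1 , s≤s (s≤s z≤n) , refl
balancedCode 0 1 _ _ = 4 , base₃₄ , 0 , s≤s z≤n , refl
balancedCode 0 2 _ _ = 4 , base₃₅ , 2 , s≤s (s≤s (s≤s z≤n)) , refl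
balancedCode 0 (suc (suc (suc _))) (s≤s (s≤s ())) _
balancedCode 1 0 _ ≢44 = contradiction (refl , refl) ≢44
balancedCode 1 (suc b) (s≤s b≤2) _ = balancedRowStar (balancedCode 0 b b≤2 λ ())
balancedCode (suc (suc q)) 0 _ _ =
  subst (BalancedCode (5 + q)) (lemma q) (balancedColStar (balancedCode q 1 (s≤s z≤n) λ ()))
  where
  lemma : ∀ q → 1 + (3 + q + 1) ≡ 3 + (2 + q) + 0
  lemma = solve-∀
-- A row star would have to start from excess 0, which for `q = 0` is the excluded pair `(4 , 4)`.
balancedCode (suc (suc q)) 1 _ _ =
  subst (BalancedCode (5 + q)) (lemma q) (balancedColStar (balancedCode q 2 (s≤s (s≤s z≤n)) λ ()))
  where
  lemma : ∀ q → 1 + (3 + q + 2) ≡ 3 + (2 + q) + 1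
  lemma = solve-∀
balancedCode (suc (suc q)) (suc (suc b)) (s≤s b<) _ =
  subst (BalancedCode (5 + q)) (lemma q b) (balancedRowStar (balancedCode (suc q) (suc b) b< λ ()))
  where
  lemma : ∀ q b → 2 + (3 + (1 + q) + (1 + b)) ≡ 3 + (2 + q) + (2 + b)
  lemma = solve-∀

-- The rounding term 2 and the remaining 1 complete another 3, so the numerator is `suc e * 3 + d`.
ceiling : ∀ e d → d < 3 → ⌈ (e * 3 + d + 2 ∸ 1) / 3 ⌉ ∸ 1 ≡ e
ceiling e d d<3 = cong (_∸ 1) (begin
  (e * 3 + d + 2 ∸ 1 + 2) / 3     ≡⟨ cong (λ k → (k + 2) / 3) (+-∸-assoc (e * 3 + d) (s≤s z≤n)) ⟩
  (e * 3 + d + 1 + 2) / 3         ≡⟨ cong (_/ 3) (lemma e d) ⟩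
  (suc e * 3 + d) / 3             ≡⟨ +-distrib-/-∣ˡ d (n∣m*n (suc e)) ⟩
  suc e * 3 / 3 + d / 3           ≡⟨ cong₂ _+_ (m*n/n≡m (suc e) 3) (m<n⇒m/n≡0 d<3) ⟩
  suc e + 0                       ≡⟨ +-identityʳ (suc e) ⟩
  suc e                           ∎)
  where
  open ≡-Reasoning
  lemma : ∀ e d → e * 3 + d + 1 + 2 ≡ suc e * 3 + d
  lemma = solve-∀

existsRobust : RobustCode n m e → ∃[ C ] LocatingDominating {K n ×ᴳ K m} C × size C ≡ e
existsRobust (xs , robust nonempty loc unique covers _ _ , len) =
  C , locating∧dominating⇒LD C loc dom , len
  where
  C : Code (K _ ×ᴳ K _)
  C = record { codewords = xs ; distinct = unique ; nonempty = nonempty }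
  dom : Dominating xs
  dom u _ u∉ _ _ with covers u
  ... | inj₁ u∈ = contradiction u∈ u∉
  ... | inj₂ a  = a

LocatingDominatingList : List (Cell n m) → Set
LocatingDominatingList xs = Locating xs × Dominating xs

locatingDominatingList? : (xs : List (Cell n m)) → Dec (LocatingDominatingList xs)
locatingDominatingList? xs = locating? xs ×-dec dominating? xs

-- This also admits codes inside a single row, which are not `Robust`.
existsDecided : (x : Cell n m) (xs : List (Cell n m))
  {_ : True (unique? _≟ᶜ_ (x ∷ xs))} {_ : True (locatingDominatingList? (x ∷ xs))} →
  ∃[ C ] LocatingDominating {K n ×ᴳ K m} C × size C ≡ suc (length xs)
existsDecided x xs {u} {l} = C , uncurry (locating∧dominating⇒LD C) (toWitness l) , refl
  where
  C : Code (K _ ×ᴳ K _)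
  C = record { codewords = x ∷ xs ; distinct = toWitness u ; nonempty = λ () }

-- Lower bounds for codes in the graph, and the four cases.

module _ (C : Code (K n ×ᴳ K m)) (ld : LocatingDominating C) where

  open LowerBounds (LD⇒locating C ld)

  m∸1≤size : m ∸ 1 ≤ size C
  m∸1≤size = m≤n+o⇒m∸n≤o _ 1 (subst (m ≤_) (+-comm (size C) 1) columns-≤)

  -- By `lines-≤`, `e * 3 + 2 ≤ size C * 3 + 4`, hence `e * 3 < suc (size C) * 3`.
  balanced≤size : ∀ {e d} → 2 * n + 2 * m ≡ e * 3 + d + 2 → e ≤ size C
  balanced≤size {e} {d} eq = ≤-pred (*-cancelʳ-< 3 e (suc (size C)) (+-cancelʳ-< 2 _ _ (begin-strict
    e * 3 + 2               ≤⟨ +-monoˡ-≤ 2 (m≤m+n (e * 3) d) ⟩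
    e * 3 + d + 2           ≡⟨ eq ⟨
    2 * n + 2 * m           ≡⟨ cong₂ _+_ (*-comm 2 n) (*-comm 2 m) ⟩
    n * 2 + m * 2           ≤⟨ lines-≤ (Code.distinct C) ⟩
    size C * 3 + 4          <⟨ ≤-refl ⟩
    suc (size C * 3 + 4)    ≡⟨ lemma (size C) ⟩
    suc (size C) * 3 + 2    ∎)))
    where
    open ≤-Reasoning
    lemma : ∀ s → suc (s * 3 + 4) ≡ suc s * 3 + 2
    lemma = solve-∀


-- The counting bounds leave size 2 open for this pair, so all lists of two cells are checked by
-- evaluation.
twoByThree : (xs : List (Cell 2 3)) → length xs ≡ 2 → ¬ LocatingDominatingList xs
twoByThree (c ∷ d ∷ []) _ = toWitness {a? = refuted?} _ c d
  where
  refuted? : Dec (∀ c d → ¬ LocatingDominatingList (c ∷ d ∷ []))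
  refuted? = allCells? λ c → allCells? λ d → ¬? (locatingDominatingList? (c ∷ d ∷ []))

twoByFour : (xs : List (Cell 2 4)) → length xs ≡ 3 → ¬ LocatingDominatingList xs
twoByFour (b ∷ c ∷ d ∷ []) _ = toWitness {a? = refuted?} _ b c d
  where
  refuted? : Dec (∀ b c d → ¬ LocatingDominatingList (b ∷ c ∷ d ∷ []))
  refuted? = allCells? λ b → allCells? λ c → allCells? λ d →
    ¬? (locatingDominatingList? (b ∷ c ∷ d ∷ []))

γ-wide : ∀ n m → 2 ≤ n → 2 * n ≤ m → (n , m) ≢ (2 , 4) → γᴸᴰ K n ×ᴳ K m ≔ (m ∸ 1)
γ-wide n m 2≤n 2n≤m ≢24 with wideCode n m 2≤n 2n≤m ≢24
... | e , refl , C = existsRobust C , m∸1≤size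

γ-balanced : ∀ n m → 2 < n → n ≤ m → m < 2 * n → (n , m) ≢ (4 , 4) →
             γᴸᴰ K n ×ᴳ K m ≔ (⌈ (2 * n + 2 * m ∸ 1) / 3 ⌉ ∸ 1)
γ-balanced n m 2<n n≤m m<2n ≢44 with m≤n⇒∃[o]m+o≡n 2<n | m≤n⇒∃[o]m+o≡n n≤m
... | p , refl | a , refl
  with balancedCode p a a≤2+p (λ { (refl , refl) → ≢44 refl })
  where
  a≤2+p : a ≤ 2 + p
  a≤2+p = ≤-pred (+-cancelˡ-< (3 + p) a (3 + p)
    (subst (λ k → 3 + p + a < 3 + p + k) (+-identityʳ (3 + p)) m<2n))
... | e , C , d , d<3 , eq =
  subst (γᴸᴰ K (3 + p) ×ᴳ K (3 + p + a) ≔_)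
    (sym (trans (cong (λ N → ⌈ (N ∸ 1) / 3 ⌉ ∸ 1) eq) (ceiling e d d<3)))
    (existsRobust C , λ C′ ld → balanced≤size C′ ld eq)

-- A full row serves as the code: a cell of the other row sees every codeword except the one in its
-- own column.
γ-two : ∀ m → 2 ≤ m → m ≤ 4 → γᴸᴰ K 2 ×ᴳ K m ≔ m
γ-two 2 _ _ =
  existsDecided (# 0 , # 0) ((# 0 , # 1) ∷ []) ,
  λ C ld → balanced≤size C ld {d = 0} refl
γ-two 3 _ _ =
  existsDecided (# 0 , # 0) ((# 0 , # 1) ∷ (# 0 , # 2) ∷ []) ,
  -- Since `10 = 2 * 3 + 2 + 2`, counting gives only size at least 2.
  λ C ld → ≤∧≢⇒< (balanced≤size C ld {d = 2} refl)
    (λ len → twoByThree (codewords C) (sym len) (LD⇒locating C ld , LD⇒dominating C ld))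
γ-two 4 _ _ =
  existsDecided (# 0 , # 0) ((# 0 , # 1) ∷ (# 0 , # 2) ∷ (# 0 , # 3) ∷ []) ,
  λ C ld → ≤∧≢⇒< (m∸1≤size C ld)
    (λ len → twoByFour (codewords C) (sym len) (LD⇒locating C ld , LD⇒dominating C ld))
γ-two (suc (suc (suc (suc (suc _))))) _ (s≤s (s≤s (s≤s (s≤s ()))))
γ-two 1 (s≤s ()) _

γ-four : γᴸᴰ K 4 ×ᴳ K 4 ≔ 5
γ-four =
  -- A path with five edges; row 3 and column 3 are empty and cross in the only solo cell.
  existsDecided (# 0 , # 0) ((# 0 , # 1) ∷ (# 1 , # 1) ∷ (# 1 , # 2) ∷ (# 2 , # 2) ∷ []) ,
  -- Since `16 = 4 * 3 + 2 + 2`, counting gives only size at least 4.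
  λ C ld → ≤∧≢⇒< (balanced≤size C ld {d = 2} refl)
    (λ len → fourByFour (Code.distinct C) (LD⇒locating C ld) (sym len) (LD⇒dominating C ld))

theorem15 : ∀ (n m : ℕ) → 2 ≤ n → n ≤ m →
    (2 * n ≤ m → (n , m) ≢ (2 , 4) →
    γᴸᴰ (K n ×ᴳ K m) ≔ (m ∸ 1)) ×
    (2 < n → m < 2 * n → (n , m) ≢ (4 , 4) →
    γᴸᴰ (K n ×ᴳ K m) ≔ (⌈ (2 * n + 2 * m ∸ 1) / 3 ⌉ ∸ 1)) ×
    (n ≡ 2 → m ≤ 4 →
    γᴸᴰ (K n ×ᴳ K m) ≔ m) ×
    (n ≡ 4 → m ≡ 4 →
    γᴸᴰ (K n ×ᴳ K m) ≔ 5)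
theorem15 n m 2≤n n≤m =
  γ-wide n m 2≤n ,
  (λ 2<n → γ-balanced n m 2<n n≤m) ,
  (λ { refl → γ-two m n≤m }) ,
  (λ { refl refl → γ-four })
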